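{- Let $\mathcal{A}=(U,\mathcal{C})$ be a convex geometry of convex dimension $d=\mathrm{cdim}(\mathcal{C})$. Then $\mathcal{A}$ is realizable in $\mathbb{R}^d$.
   Context: A convex geometry is a pair $(U,\mathcal{C})$ with $U$ a finite set and $\mathcal{C}\subseteq 2^U$ such that (C1) $\varnothing,U\in\mathcal{C}$; (C2) $X\cap Y\in\mathcal{C}$ for all $X,Y\in\mathcal{C}$; (C3) for every $X\in\mathcal{C}\setminus\{U\}$ there is $e\in U\setminus X$ with $X\cup\{e\}\in\mathcal{C}$. A set $\{\leq_1,\dots,\leq_d\}$ of total orders on $U$ generates $\mathcal{C}\subseteq 2^U$ if $\varnothing\in\mathcal{C}$ and a nonempty set $C\subseteq U$ belongs to $\mathcal{C}$ if and only if there are $e_1,\dots,e_d\in U$ with $C=\{e\in U: e_i\leq_i e\text{ for all }1\leq i\leq d\}$. Every convex geometry is generated by some set of total orders; the convex dimension $\mathrm{cdim}(\mathcal{C})$ is the least number of total orders generating $\mathcal{C}$. A family $\mathcal{C}\subseteq 2^U$ is realizable in $\mathbb{R}^d$ if there are oriented affine hyperplanes $(H_e)_{e\in U}$ of $\mathbb{R}^d$, where $H_e=\{x:a_e\cdot x=b_e\}$ with $a_e\neq 0$, $H_e^+=\{x: a_e\cdot x>b_e\}$, $H_e^-=\{x:a_e\cdot x<b_e\}$, and a relatively open convex set $K\subseteq\mathbb{R}^d$ such that a set $X\subseteq U$ belongs to $\mathcal{C}$ if and only if there is $x\in K$ with $x\in H_e^+$ for all $e\in X$ and $x\in H_e^-$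 for all $e\in U\setminus X$. -}

module Defs where

open import Data.Fin.Base using (Fin)
open import Data.Fin.Subset using (Subset; _∈_; _∉_; _∩_; _∪_; ⁅_⁆; ⊥; ⊤; Nonempty)
open import Data.Nat.Base as ℕ using (ℕ; _⊔_)
import Data.Nat.Properties as ℕ
open import Data.Product.Base using (Σ; ∃; ∃-syntax; _×_; _,_)
open import Data.Rational.Base as ℚ using (ℚ; 0ℚ; 1ℚ; ∣_∣)
import Data.Rational.Properties as ℚ
open import Data.Rational.Solver using (module +-*-Solver)
open import Data.Vec.Functional using (Vector; foldr)
open import Function.Bundles using (_⇔_)
open import Level using (0ℓ)
open import Relation.Binary.Core using (Rel)
open import Relation.Binary.PropositionalEquality
  using (_≡_; _≢_; refl; sym; trans; cong; cong₂; subst)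
open import Relation.Binary.Structures using (IsTotalOrder)
open import Relation.Nullary.Negation using (¬_)
open import Relation.Unary using (Pred)

------------------------------------------------------------------------
-- The real numbers, as Cauchy sequences of rationals. Two sequences
-- denote the same real when they are related by _≃_.

Eventually : (ℕ → Set) → Set
Eventually P = ∃[ N ] ∀ k → N ℕ.≤ k → P k

IsCauchy : (ℕ → ℚ) → Set
IsCauchy s = ∀ ε → 0ℚ ℚ.< ε →
  ∃[ N ] ∀ j k → N ℕ.≤ j → N ℕ.≤ k → ∣ s j ℚ.- s k ∣ ℚ.< ε

record ℝ : Set where
  constructor mkℝ
  field
    seq    : ℕ → ℚ
    cauchy : IsCauchy seq

open ℝ public

abstract
  0<½* : ∀ {ε} → 0ℚ ℚ.< ε → 0ℚ ℚ.< ℚ.½ ℚ.* ε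
  0<½* {ε} 0<ε = subst (ℚ._< ℚ.½ ℚ.* ε) (ℚ.*-zeroʳ ℚ.½) (ℚ.*-monoʳ-<-pos ℚ.½ 0<ε)

  halves : ∀ ε → ℚ.½ ℚ.* ε ℚ.+ ℚ.½ ℚ.* ε ≡ ε
  halves ε = trans (sym (ℚ.*-distribʳ-+ ε ℚ.½ ℚ.½)) (ℚ.*-identityˡ ε)

  const-cauchy : ∀ q → IsCauchy (λ _ → q)
  const-cauchy q ε 0<ε = 0 , λ _ _ _ _ →
    subst (ℚ._< ε) (sym (cong ∣_∣ (ℚ.+-inverseʳ q))) 0<ε

  +-cauchy : ∀ s t → IsCauchy s → IsCauchy t → IsCauchy (λ k → s k ℚ.+ t k)
  +-cauchy s t cs ct ε 0<ε =
    let M , hM = cs (ℚ.½ ℚ.* ε) (0<½* 0<ε)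
        N , hN = ct (ℚ.½ ℚ.* ε) (0<½* 0<ε)
    in M ⊔ N , λ j k j≥ k≥ → let open ℚ.≤-Reasoning in begin-strict
      ∣ (s j ℚ.+ t j) ℚ.- (s k ℚ.+ t k) ∣
        ≡⟨ cong ∣_∣ (solve 4 (λ a b c d → (a :+ b) :- (c :+ d) := (a :- c) :+ (b :- d))
             refl (s j) (t j) (s k) (t k)) ⟩
      ∣ (s j ℚ.- s k) ℚ.+ (t j ℚ.- t k) ∣
        ≤⟨ ℚ.∣p+q∣≤∣p∣+∣q∣ (s j ℚ.- s k) (t j ℚ.- t k) ⟩
      ∣ s j ℚ.- s k ∣ ℚ.+ ∣ t j ℚ.- t k ∣
        <⟨ ℚ.+-mono-< (hM j k (ℕ.m⊔n≤o⇒m≤o M N j≥) (ℕ.m⊔n≤o⇒m≤o M N k≥))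
                      (hN j k (ℕ.m⊔n≤o⇒n≤o M N j≥) (ℕ.m⊔n≤o⇒n≤o M N k≥)) ⟩
      ℚ.½ ℚ.* ε ℚ.+ ℚ.½ ℚ.* ε
        ≡⟨ halves ε ⟩
      ε ∎
    where open +-*-Solver

  neg-cauchy : ∀ s → IsCauchy s → IsCauchy (λ k → ℚ.- s k)
  neg-cauchy s cs ε 0<ε =
    let N , h = cs ε 0<ε
    in N , λ j k j≥ k≥ → subst (ℚ._< ε)
         (trans (sym (ℚ.∣-p∣≡∣p∣ (s j ℚ.- s k)))
                (cong ∣_∣ (ℚ.neg-distrib-+ (s j) (ℚ.- s k))))
         (h j k j≥ k≥)

  bounded : ∀ s → IsCauchy s →
    ∃[ B ] 0ℚ ℚ.< B × Eventually (λ k → ∣ s k ∣ ℚ.≤ B)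
  bounded s cs =
    let N , h = cs 1ℚ (ℚ.positive⁻¹ 1ℚ)
    in  1ℚ ℚ.+ ∣ s N ∣
     ,  ℚ.+-mono-<-≤ (ℚ.positive⁻¹ 1ℚ) (ℚ.0≤∣p∣ (s N))
     ,  N , λ k k≥ → let open ℚ.≤-Reasoning in begin
          ∣ s k ∣
            ≡⟨ cong ∣_∣ (solve 2 (λ a b → a := (a :- b) :+ b) refl (s k) (s N)) ⟩
          ∣ (s k ℚ.- s N) ℚ.+ s N ∣
            ≤⟨ ℚ.∣p+q∣≤∣p∣+∣q∣ (s k ℚ.- s N) (s N) ⟩
          ∣ s k ℚ.- s N ∣ ℚ.+ ∣ s N ∣
            ≤⟨ ℚ.+-monoˡ-≤ ∣ s N ∣ (ℚ.<⇒≤ (h k N k≥ ℕ.≤-refl)) ⟩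
          1ℚ ℚ.+ ∣ s N ∣ ∎
    where open +-*-Solver

  shrink : ∀ B ε → 0ℚ ℚ.< B → 0ℚ ℚ.< ε → ∃[ δ ] 0ℚ ℚ.< δ × B ℚ.* δ ≡ ε
  shrink B ε 0<B 0<ε = B⁻¹ ℚ.* ε
    , subst (ℚ._< B⁻¹ ℚ.* ε) (ℚ.*-zeroʳ B⁻¹) (ℚ.*-monoʳ-<-pos B⁻¹ 0<ε)
    , trans (sym (ℚ.*-assoc B B⁻¹ ε))
        (trans (cong (ℚ._* ε) (ℚ.*-inverseʳ B)) (ℚ.*-identityˡ ε))
    where
    instance
      B-pos : ℚ.Positive B
      B-pos = ℚ.positive 0<B
      B-nonZero : ℚ.NonZero B
      B-nonZero = ℚ.pos⇒nonZero B
    B⁻¹ : ℚ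
    B⁻¹ = ℚ.1/ B
    instance
      B⁻¹-pos : ℚ.Positive B⁻¹
      B⁻¹-pos = ℚ.1/pos⇒pos B

  ∣*∣-bound : ∀ p q {B δ} → 0ℚ ℚ.< B → ∣ p ∣ ℚ.≤ B → ∣ q ∣ ℚ.< δ →
    ∣ p ℚ.* q ∣ ℚ.< B ℚ.* δ
  ∣*∣-bound p q {B} {δ} 0<B p≤B q<δ = begin-strict
    ∣ p ℚ.* q ∣       ≡⟨ ℚ.∣p*q∣≡∣p∣*∣q∣ p q ⟩
    ∣ p ∣ ℚ.* ∣ q ∣   ≤⟨ ℚ.*-monoʳ-≤-nonNeg ∣ q ∣ {{ℚ.nonNegative (ℚ.0≤∣p∣ q)}} p≤B ⟩
    B ℚ.* ∣ q ∣       <⟨ ℚ.*-monoʳ-<-pos B {{ℚ.positive 0<B}} q<δ ⟩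
    B ℚ.* δ           ∎
    where open ℚ.≤-Reasoning

  *-cauchy : ∀ s t → IsCauchy s → IsCauchy t → IsCauchy (λ k → s k ℚ.* t k)
  *-cauchy s t cs ct ε 0<ε =
    let A , 0<A , K , hK = bounded s cs
        B , 0<B , L , hL = bounded t ct
        α , 0<α , Aα≡    = shrink A (ℚ.½ ℚ.* ε) 0<A (0<½* 0<ε)
        β , 0<β , Bβ≡    = shrink B (ℚ.½ ℚ.* ε) 0<B (0<½* 0<ε)
        M , hM           = ct α 0<α
        N , hN           = cs β 0<β
    in (K ⊔ L) ⊔ (M ⊔ N) , λ j k j≥ k≥ →
      let kl≤j = ℕ.m⊔n≤o⇒m≤o (K ⊔ L) (M ⊔ N) j≥
          kl≤k = ℕ.m⊔n≤o⇒m≤o (K ⊔ L) (M ⊔ N) k≥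
          mn≤j = ℕ.m⊔n≤o⇒n≤o (K ⊔ L) (M ⊔ N) j≥
          mn≤k = ℕ.m⊔n≤o⇒n≤o (K ⊔ L) (M ⊔ N) k≥
          open ℚ.≤-Reasoning
      in begin-strict
      ∣ s j ℚ.* t j ℚ.- s k ℚ.* t k ∣
        ≡⟨ cong ∣_∣ (solve 4 (λ a b c d →
             a :* b :- c :* d := a :* (b :- d) :+ d :* (a :- c))
             refl (s j) (t j) (s k) (t k)) ⟩
      ∣ s j ℚ.* (t j ℚ.- t k) ℚ.+ t k ℚ.* (s j ℚ.- s k) ∣
        ≤⟨ ℚ.∣p+q∣≤∣p∣+∣q∣ (s j ℚ.* (t j ℚ.- t k)) (t k ℚ.* (s j ℚ.- s k)) ⟩
      ∣ s j ℚ.* (t j ℚ.- t k) ∣ ℚ.+ ∣ t k ℚ.* (s j ℚ.- s k) ∣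
        <⟨ ℚ.+-mono-<
             (∣*∣-bound (s j) (t j ℚ.- t k) 0<A
               (hK j (ℕ.m⊔n≤o⇒m≤o K L kl≤j))
               (hM j k (ℕ.m⊔n≤o⇒m≤o M N mn≤j) (ℕ.m⊔n≤o⇒m≤o M N mn≤k)))
             (∣*∣-bound (t k) (s j ℚ.- s k) 0<B
               (hL k (ℕ.m⊔n≤o⇒n≤o K L kl≤k))
               (hN j k (ℕ.m⊔n≤o⇒n≤o M N mn≤j) (ℕ.m⊔n≤o⇒n≤o M N mn≤k))) ⟩
      A ℚ.* α ℚ.+ B ℚ.* β
        ≡⟨ cong₂ ℚ._+_ Aα≡ Bβ≡ ⟩
      ℚ.½ ℚ.* ε ℚ.+ ℚ.½ ℚ.* ε
        ≡⟨ halves ε ⟩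
      ε ∎
    where open +-*-Solver

infixl 6 _+_ _-_
infixl 7 _*_
infix  8 -_
infix  4 _≃_ _<_ _≤_

fromℚ : ℚ → ℝ
fromℚ q = mkℝ (λ _ → q) (const-cauchy q)

0ℝ 1ℝ : ℝ
0ℝ = fromℚ 0ℚ
1ℝ = fromℚ 1ℚ

_+_ _*_ : ℝ → ℝ → ℝ
x + y = mkℝ (λ k → seq x k ℚ.+ seq y k) (+-cauchy (seq x) (seq y) (cauchy x) (cauchy y))
x * y = mkℝ (λ k → seq x k ℚ.* seq y k) (*-cauchy (seq x) (seq y) (cauchy x) (cauchy y))

-_ : ℝ → ℝ
-_ x = mkℝ (λ k → ℚ.- seq x k) (neg-cauchy (seq x) (cauchy x))

_-_ : ℝ → ℝ → ℝ
_-_ x y = x + (- y)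

_≃_ _<_ _≤_ : Rel ℝ 0ℓ
x ≃ y = ∀ ε → 0ℚ ℚ.< ε → Eventually λ k → ∣ seq x k ℚ.- seq y k ∣ ℚ.< ε
x < y = ∃[ ε ] 0ℚ ℚ.< ε × Eventually λ k → seq x k ℚ.+ ε ℚ.< seq y k
x ≤ y = ∀ ε → 0ℚ ℚ.< ε → Eventually λ k → seq x k ℚ.< seq y k ℚ.+ ε

------------------------------------------------------------------------
-- Euclidean space

infix  4 _≃ᵥ_
infixl 6 _+ᵥ_ _-ᵥ_
infixl 7 _·_ _*ᵥ_

ℝ^ : ℕ → Set
ℝ^ d = Vector ℝ d

0ᵥ : ∀ {d} → ℝ^ d
0ᵥ _ = 0ℝ

_≃ᵥ_ : ∀ {d} → Rel (ℝ^ d) 0ℓ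
x ≃ᵥ y = ∀ i → x i ≃ y i

_+ᵥ_ _-ᵥ_ : ∀ {d} → ℝ^ d → ℝ^ d → ℝ^ d
(x +ᵥ y) i = x i + y i
(x -ᵥ y) i = x i - y i

_*ᵥ_ : ∀ {d} → ℝ → ℝ^ d → ℝ^ d
(t *ᵥ x) i = t * x i

sum : ∀ {m} → Vector ℝ m → ℝ
sum = foldr _+_ 0ℝ

sumᵥ : ∀ {m d} → Vector (ℝ^ d) m → ℝ^ d
sumᵥ = foldr _+ᵥ_ 0ᵥ

_·_ : ∀ {d} → ℝ^ d → ℝ^ d → ℝ
x · y = sum λ i → x i * y i

Convex : ∀ {d} → Pred (ℝ^ d) 0ℓ → Set
Convex K = ∀ x y t → K x → K y → 0ℝ ≤ t → t ≤ 1ℝ →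
  K ((1ℝ - t) *ᵥ x +ᵥ t *ᵥ y)

AffineHull : ∀ {d} → Pred (ℝ^ d) 0ℓ → Pred (ℝ^ d) 0ℓ
AffineHull {d} K y =
  ∃[ m ] Σ (Vector (ℝ^ d) m) λ p → Σ (Vector ℝ m) λ c →
    (∀ j → K (p j)) × sum c ≃ 1ℝ × y ≃ᵥ sumᵥ (λ j → c j *ᵥ p j)

-- The Euclidean ball ‖y - x‖ < ε is written with squares. Since the
-- affine hull is closed under _≃ᵥ_, so is every relatively open set.
RelativelyOpen : ∀ {d} → Pred (ℝ^ d) 0ℓ → Set
RelativelyOpen K = ∀ x → K x → ∃[ ε ] 0ℝ < ε ×
  (∀ y → AffineHull K y → (y -ᵥ x) · (y -ᵥ x) < ε * ε → K y)

------------------------------------------------------------------------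
-- Families of subsets of the finite set U = Fin n

Family : ℕ → Set₁
Family n = Pred (Subset n) 0ℓ

record IsConvexGeometry {n} (𝒞 : Family n) : Set where
  field
    ⊥-closed   : 𝒞 ⊥
    ⊤-closed   : 𝒞 ⊤
    ∩-closed   : ∀ X Y → 𝒞 X → 𝒞 Y → 𝒞 (X ∩ Y)
    extendable : ∀ X → 𝒞 X → X ≢ ⊤ → ∃[ e ] e ∉ X × 𝒞 (X ∪ ⁅ e ⁆)

record Generates {n d} (_≤[_]_ : Fin n → Fin d → Fin n → Set) (𝒞 : Family n) : Set where
  field
    totalOrders : ∀ i → IsTotalOrder _≡_ (λ x y → x ≤[ i ] y)
    ⊥-closed    : 𝒞 ⊥
    nonempty    : ∀ C → Nonempty C →
      𝒞 C ⇔ (Σ (Fin d → Fin n) λ e → ∀ x → x ∈ C ⇔ (∀ i → e i ≤[ i ] x))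

-- The orders are indexed by Fin d and may repeat; discarding repetitions
-- does not change the generated family, so the least d is unaffected.
GeneratedBy : ∀ {n} → ℕ → Family n → Set₁
GeneratedBy {n} d 𝒞 = Σ (Fin n → Fin d → Fin n → Set) λ ≤[] → Generates ≤[] 𝒞

-- At least one order is required. Zero orders would generate only the
-- geometries with at most one element, and ℝ⁰ contains no hyperplane with
-- a ≠ 0 to realize the one-element geometry.
record IsConvexDimension {n} (𝒞 : Family n) (d : ℕ) : Set₁ where
  field
    positive  : 1 ℕ.≤ d
    generated : GeneratedBy d 𝒞
    least     : ∀ d′ → 1 ℕ.≤ d′ → GeneratedBy d′ 𝒞 → d ℕ.≤ d′

-- H⁺ and H⁻ are the open sides of the hyperplane a · x ≃ b.
H⁺ H⁻ : ∀ {d} → ℝ^ d → ℝ → Pred (ℝ^ d) 0ℓ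
H⁺ a b x = b < a · x
H⁻ a b x = a · x < b

record Realizable {n} (𝒞 : Family n) (d : ℕ) : Set₁ where
  field
    a              : Fin n → ℝ^ d
    b              : Fin n → ℝ
    a≄0            : ∀ e → ¬ (a e ≃ᵥ 0ᵥ)
    K              : Pred (ℝ^ d) 0ℓ
    relativelyOpen : RelativelyOpen K
    convex         : Convex K
    realizes       : ∀ X → 𝒞 X ⇔ (∃[ x ] K x
      × (∀ e → e ∈ X → H⁺ (a e) (b e) x)
      × (∀ e → e ∉ X → H⁻ (a e) (b e) x))

{-# OPTIONS --safe #-}

-- Let rᵢ(e) be the number of f with e ≤ᵢ f, and put M = d + 2. For y in the
-- open positive orthant let X(y) = {e : ∑ᵢ M^rᵢ(e) yᵢ < (d + 1) Mⁿ}. If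
-- e₁, …, e_d ∈ X(y) and eᵢ <ᵢ x for all i, then M^(1 + rᵢ(x)) yᵢ ≤ M^rᵢ(eᵢ) yᵢ
-- < (d + 1) Mⁿ, and summing over i gives x ∈ X(y); hence X(y) is empty or the
-- intersection of the filters of its least elements. Conversely the point
-- yᵢ = M^(n - rᵢ(eᵢ)) realizes the intersection of the filters of the eᵢ: on it
-- every term of the sum is at most Mⁿ, and off it some term is at least Mⁿ⁺¹.
module Submission where

open import Defs
open import Algebra.Bundles using (CommutativeRing)
open import Data.Fin.Base using (Fin; zero; suc; fromℕ<)
open import Data.Fin.Properties as Fin using (¬∀⟶∃¬)
open import Data.Fin.Subset using (Subset; _∈_; _∉_; _⊆_; Nonempty) renaming (∣_∣ to card)
open import Data.Fin.Subset.Properties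
  using (_∈?_; nonempty?; Empty-unique; ∣p∣≤n; p⊆q⇒∣p∣≤∣q∣; p⊂q⇒∣p∣<∣q∣)
import Data.List.Base as List
import Data.List.Extrema as Extrema
open import Data.List.Membership.Propositional.Properties using (∈-allFin; ∈-filter⁺)
import Data.List.Relation.Unary.All as All
open import Data.List.Relation.Unary.All.Properties using (all-filter)
open import Data.Nat.Base as ℕ using (ℕ; _^_; _∸_; _⊔_)
import Data.Nat.Properties as ℕ
open import Data.Product.Base using (∃-syntax; _×_; _,_; proj₁; proj₂)
open import Data.Rational.Base as ℚ using (ℚ; 0ℚ; 1ℚ; ½)
import Data.Rational.Properties as ℚ
open import Data.Rational.Solver using (module +-*-Solver)
open import Data.Sum.Base using (inj₁; inj₂)
open import Data.Vec.Base using (tabulate)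
open import Data.Vec.Functional using (Vector)
open import Data.Vec.Properties using ([]=⇒lookup; lookup⇒[]=; lookup∘tabulate)
open import Function.Base using (_∘_)
open import Function.Bundles using (Equivalence; mk⇔)
open import Relation.Binary.Bundles using (TotalOrder)
open import Relation.Binary.Consequences using (total∧dec⇒dec)
open import Relation.Binary.Definitions using (Decidable)
open import Relation.Binary.PropositionalEquality
  using (_≡_; refl; sym; trans; cong; cong₂; subst; subst₂; module ≡-Reasoning)
open import Relation.Binary.Structures using (IsTotalOrder)
open import Relation.Nullary.Decidable
  using (yes; no; does; dec-true; decidable-stable; from-yes)
open import Relation.Nullary.Negation using (¬_; contradiction)
open import Relation.Unary using (Pred)

open import Algebra.Properties.Semiring.Sum (CommutativeRing.semiring ℚ.+-*-commutativeRing)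
  using (*-distribˡ-sum) renaming (sum to ∑)
open import Algebra.Properties.Semiring.Mult (CommutativeRing.semiring ℚ.+-*-commutativeRing)
  using (×1-homo-*) renaming (_×_ to _×ℚ_)

-- Finite sums and order in the rationals.

∑-nonNeg : ∀ {m} (t : Vector ℚ m) → (∀ i → 0ℚ ℚ.≤ t i) → 0ℚ ℚ.≤ ∑ t
∑-nonNeg {ℕ.zero}  t 0≤t = ℚ.≤-refl
∑-nonNeg {ℕ.suc m} t 0≤t = ℚ.+-mono-≤ (0≤t zero) (∑-nonNeg (t ∘ suc) (0≤t ∘ suc))

term≤∑ : ∀ {m} (t : Vector ℚ m) → (∀ i → 0ℚ ℚ.≤ t i) → ∀ i → t i ℚ.≤ ∑ t
term≤∑ t 0≤t zero    = subst (ℚ._≤ ∑ t) (ℚ.+-identityʳ (t zero))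
  (ℚ.+-monoʳ-≤ (t zero) (∑-nonNeg (t ∘ suc) (0≤t ∘ suc)))
term≤∑ t 0≤t (suc i) = subst (ℚ._≤ ∑ t) (ℚ.+-identityˡ (t (suc i)))
  (ℚ.+-mono-≤ (0≤t zero) (term≤∑ (t ∘ suc) (0≤t ∘ suc) i))

neg-∑ : ∀ {m} (t z : Vector ℚ m) → ∑ (λ i → ℚ.- t i ℚ.* z i) ≡ ℚ.- ∑ (λ i → t i ℚ.* z i)
neg-∑ {ℕ.zero}  t z = refl
neg-∑ {ℕ.suc m} t z = trans
  (cong₂ ℚ._+_ (sym (ℚ.neg-distribˡ-* (t zero) (z zero))) (neg-∑ (t ∘ suc) (z ∘ suc)))
  (sym (ℚ.neg-distrib-+ (t zero ℚ.* z zero) (∑ (λ i → t (suc i) ℚ.* z (suc i)))))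

neg-cancel-< : ∀ p q → ℚ.- p ℚ.< ℚ.- q → q ℚ.< p
neg-cancel-< p q -p<-q = subst₂ ℚ._<_ (neg-neg q) (neg-neg p) (ℚ.neg-antimono-< -p<-q)
  where
  open +-*-Solver
  neg-neg : ∀ p → ℚ.- (ℚ.- p) ≡ p
  neg-neg = solve 1 (λ p → :- (:- p) := p) refl

0≤* : ∀ p q → 0ℚ ℚ.≤ p → 0ℚ ℚ.≤ q → 0ℚ ℚ.≤ p ℚ.* q
0≤* p q 0≤p 0≤q = subst (ℚ._≤ p ℚ.* q) (ℚ.*-zeroʳ p)
  (ℚ.*-monoˡ-≤-nonNeg p {{ℚ.nonNegative 0≤p}} 0≤q)

0≤p² : ∀ p → 0ℚ ℚ.≤ p ℚ.* p
0≤p² p with ℚ.≤-total 0ℚ p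
... | inj₁ 0≤p = 0≤* p p 0≤p 0≤p
... | inj₂ p≤0 = subst (0ℚ ℚ.≤_) (solve 1 (λ p → :- p :* :- p := p :* p) refl p)
  (0≤* (ℚ.- p) (ℚ.- p) (ℚ.neg-antimono-≤ p≤0) (ℚ.neg-antimono-≤ p≤0))
  where open +-*-Solver

-- If p ≤ -q, then 0 < q ≤ -p, and squaring gives q² ≤ p². This turns a bound on a squared distance
-- into a lower bound on one coordinate difference.
p²<q²⇒-q<p : ∀ p q → 0ℚ ℚ.< q → p ℚ.* p ℚ.< q ℚ.* q → ℚ.- q ℚ.< p
p²<q²⇒-q<p p q 0<q p²<q² = ℚ.≰⇒> λ p≤-q →
  let q≤-p = subst (ℚ._≤ ℚ.- p) (solve 1 (λ q → :- (:- q) := q) refl q) (ℚ.neg-antimono-≤ p≤-q)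
  in ℚ.<-irrefl refl (begin-strict
    p ℚ.* p             <⟨ p²<q² ⟩
    q ℚ.* q             ≤⟨ ℚ.*-monoˡ-≤-nonNeg q {{ℚ.nonNegative (ℚ.<⇒≤ 0<q)}} q≤-p ⟩
    q ℚ.* ℚ.- p         ≤⟨ ℚ.*-monoʳ-≤-nonNeg (ℚ.- p) {{ℚ.nonNegative (ℚ.≤-trans (ℚ.<⇒≤ 0<q) q≤-p)}} q≤-p ⟩
    ℚ.- p ℚ.* ℚ.- p     ≡⟨ solve 1 (λ p → :- p :* :- p := p :* p) refl p ⟩
    p ℚ.* p             ∎)
  where
  open ℚ.≤-Reasoning
  open +-*-Solver

p≤∣p∣ : ∀ p → p ℚ.≤ ℚ.∣ p ∣
p≤∣p∣ p with ℚ.≤-total 0ℚ p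
... | inj₁ 0≤p = ℚ.≤-reflexive (sym (ℚ.0≤p⇒∣p∣≡p 0≤p))
... | inj₂ p≤0 = ℚ.≤-trans p≤0 (ℚ.0≤∣p∣ p)

p<q⇒0<q-p : ∀ {p q} → p ℚ.< q → 0ℚ ℚ.< q ℚ.- p
p<q⇒0<q-p {p} {q} p<q = subst (ℚ._< q ℚ.- p) (ℚ.+-inverseʳ p) (ℚ.+-monoˡ-< (ℚ.- p) p<q)

p<p+q : ∀ p {q} → 0ℚ ℚ.< q → p ℚ.< p ℚ.+ q
p<p+q p {q} 0<q = subst (ℚ._< p ℚ.+ q) (ℚ.+-identityʳ p) (ℚ.+-monoʳ-< p 0<q)

-- As a multiple of 1, the embedding is multiplicative by `×1-homo-*` and its monotonicity follows
-- by induction.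
fromℕ : ℕ → ℚ
fromℕ n = n ×ℚ 1ℚ

fromℕ-suc : ∀ n → fromℕ n ℚ.< fromℕ (ℕ.suc n)
fromℕ-suc n = subst (fromℕ n ℚ.<_) (ℚ.+-comm (fromℕ n) 1ℚ) (p<p+q (fromℕ n) (ℚ.positive⁻¹ 1ℚ))

fromℕ-mono-≤ : ∀ {m n} → m ℕ.≤ n → fromℕ m ℚ.≤ fromℕ n
fromℕ-mono-≤ {n = ℕ.zero}  ℕ.z≤n       = ℚ.≤-refl
fromℕ-mono-≤ {n = ℕ.suc n} ℕ.z≤n       = ℚ.≤-trans (fromℕ-mono-≤ {n = n} ℕ.z≤n) (ℚ.<⇒≤ (fromℕ-suc n))
fromℕ-mono-≤               (ℕ.s≤s m≤n) = ℚ.+-monoʳ-≤ 1ℚ (fromℕ-mono-≤ m≤n)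

fromℕ-mono-< : ∀ {m n} → m ℕ.< n → fromℕ m ℚ.< fromℕ n
fromℕ-mono-< {m} m<n = ℚ.<-≤-trans (fromℕ-suc m) (fromℕ-mono-≤ m<n)

0≤fromℕ : ∀ n → 0ℚ ℚ.≤ fromℕ n
0≤fromℕ n = fromℕ-mono-≤ {n = n} ℕ.z≤n

∑≤ : ∀ {m} (t : Vector ℚ m) c → (∀ i → t i ℚ.≤ c) → ∑ t ℚ.≤ fromℕ m ℚ.* c
∑≤ {ℕ.zero}  t c t≤c = ℚ.≤-reflexive (sym (ℚ.*-zeroˡ c))
∑≤ {ℕ.suc m} t c t≤c = begin
  t zero ℚ.+ ∑ (t ∘ suc)          ≤⟨ ℚ.+-mono-≤ (t≤c zero) (∑≤ (t ∘ suc) c (t≤c ∘ suc)) ⟩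
  c ℚ.+ fromℕ m ℚ.* c             ≡⟨ solve 2 (λ c m → c :+ m :* c := (con 1ℚ :+ m) :* c) refl c (fromℕ m) ⟩
  fromℕ (ℕ.suc m) ℚ.* c           ∎
  where
  open ℚ.≤-Reasoning
  open +-*-Solver

-- Eventual properties and strict inequalities of Cauchy sequences.

eventually-all : ∀ {m} {P : Fin m → ℕ → Set} →
  (∀ i → Eventually (P i)) → Eventually (λ k → ∀ i → P i k)
eventually-all {ℕ.zero}  h = 0 , λ _ _ ()
eventually-all {ℕ.suc m} h =
  let M , hM = h zero
      N , hN = eventually-all (h ∘ suc)
  in M ⊔ N , λ where
    k k≥ zero    → hM k (ℕ.m⊔n≤o⇒m≤o M N k≥)
    k k≥ (suc i) → hN k (ℕ.m⊔n≤o⇒n≤o M N k≥) i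

eventually-× : ∀ {P Q : ℕ → Set} → Eventually P → Eventually Q → Eventually (λ k → P k × Q k)
eventually-× (M , hM) (N , hN) = M ⊔ N , λ k k≥ →
  hM k (ℕ.m⊔n≤o⇒m≤o M N k≥) , hN k (ℕ.m⊔n≤o⇒n≤o M N k≥)

<⇒eventually : ∀ x y → x < y → Eventually (λ k → seq x k ℚ.< seq y k)
<⇒eventually x y (ε , 0<ε , N , h) = N , λ k k≥ → ℚ.<-trans (p<p+q (seq x k) 0<ε) (h k k≥)

constant-< : ∀ x y {p q} → (∀ k → seq x k ≡ p) → (∀ k → seq y k ≡ q) → p ℚ.< q → x < y
constant-< x y {p} {q} x≡p y≡q p<q =
  -- The gap must stay strictly below q - p, so it is measured to an intermediate point m.
  let m , p<m , m<q = ℚ.<-dense p<q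
  in m ℚ.- p , p<q⇒0<q-p p<m , 0 , λ k _ →
    subst₂ ℚ._<_
      (trans (solve 2 (λ m p → m := p :+ (m :- p)) refl m p) (cong (ℚ._+ (m ℚ.- p)) (sym (x≡p k))))
      (sym (y≡q k)) m<q
  where open +-*-Solver

-- Real addition acts index by index, so this is an equality of rationals and not only one up to
-- `_≃_`. It carries claims about dot products over to ℚ.
seq-sum : ∀ {m} (v : Vector ℝ m) k → seq (sum v) k ≡ ∑ (λ i → seq (v i) k)
seq-sum {ℕ.zero}  v k = refl
seq-sum {ℕ.suc m} v k = cong (seq (v zero) k ℚ.+_) (seq-sum (v ∘ suc) k)

-- The open positive orthant.

-- A real is positive when its sequence eventually exceeds a fixed positive rational. The finitely
-- many coordinates share one such bound and one starting index.
Orthant : ∀ {d} → Pred (ℝ^ d) _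
Orthant y = ∃[ η ] 0ℚ ℚ.< η × Eventually (λ k → ∀ i → η ℚ.< seq (y i) k)

-- The radius is half the margin η. Each squared coordinate difference is at most the squared
-- distance, so every coordinate drops by less than η/2 and stays above η/2.
orthant-relativelyOpen : ∀ {d} → RelativelyOpen (Orthant {d})
orthant-relativelyOpen x (η , 0<η , N , hx) =
  fromℚ h , constant-< 0ℝ (fromℚ h) (λ _ → refl) (λ _ → refl) 0<h , λ y _ y-x<h → h , 0<h ,
    (let M , hM = <⇒eventually ((y -ᵥ x) · (y -ᵥ x)) (fromℚ h * fromℚ h) y-x<h
     in M ⊔ N , λ k k≥ i →
      let δ = λ i → seq (y i) k ℚ.- seq (x i) k
          -h<δ = p²<q²⇒-q<p (δ i) h 0<h (ℚ.≤-<-trans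
            (term≤∑ (λ i → δ i ℚ.* δ i) (λ i → 0≤p² (δ i)) i)
            (subst (ℚ._< h ℚ.* h)
              (seq-sum (λ i → (y i - x i) * (y i - x i)) k)
              (hM k (ℕ.m⊔n≤o⇒m≤o M N k≥))))
      in begin-strict
        h                           ≡⟨ solve 1 (λ h → h := :- h :+ (h :+ h)) refl h ⟩
        ℚ.- h ℚ.+ (h ℚ.+ h)         ≡⟨ cong (ℚ.- h ℚ.+_) (halves η) ⟩
        ℚ.- h ℚ.+ η                 <⟨ ℚ.+-mono-< -h<δ (hx k (ℕ.m⊔n≤o⇒n≤o M N k≥) i) ⟩
        δ i ℚ.+ seq (x i) k         ≡⟨ solve 2 (λ y x → y :- x :+ x := y) refl (seq (y i) k) (seq (x i) k) ⟩
        seq (y i) k                 ∎)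
  where
  h   = ½ ℚ.* η
  0<h = 0<½* 0<η
  open ℚ.≤-Reasoning
  open +-*-Solver

-- The product (p + δ)u is positive and uδ ≤ Bδ. Here p is a coefficient known to be nonnegative
-- only up to the tolerance δ.
perturbed-product : ∀ p {u B δ} → 0ℚ ℚ.< u → u ℚ.≤ B → 0ℚ ℚ.< δ → 0ℚ ℚ.< p ℚ.+ δ →
  0ℚ ℚ.< p ℚ.* u ℚ.+ B ℚ.* δ
perturbed-product p {u} {B} {δ} 0<u u≤B 0<δ 0<p+δ = begin-strict
  0ℚ                        ≡⟨ ℚ.*-zeroˡ u ⟨
  0ℚ ℚ.* u                  <⟨ ℚ.*-monoˡ-<-pos u {{ℚ.positive 0<u}} 0<p+δ ⟩
  (p ℚ.+ δ) ℚ.* u           ≡⟨ solve 3 (λ p δ u → (p :+ δ) :* u := p :* u :+ u :* δ) refl p δ u ⟩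
  p ℚ.* u ℚ.+ u ℚ.* δ       ≤⟨ ℚ.+-monoʳ-≤ (p ℚ.* u) (ℚ.*-monoʳ-≤-nonNeg δ {{ℚ.nonNegative (ℚ.<⇒≤ 0<δ)}} u≤B) ⟩
  p ℚ.* u ℚ.+ B ℚ.* δ       ∎
  where
  open ℚ.≤-Reasoning
  open +-*-Solver

positive-lower-bound : ∀ {p q} → 0ℚ ℚ.< p → 0ℚ ℚ.< q → ∃[ r ] 0ℚ ℚ.< r × r ℚ.≤ p × r ℚ.≤ q
positive-lower-bound {p} {q} 0<p 0<q with ℚ.≤-total p q
... | inj₁ p≤q = p , 0<p , ℚ.≤-refl , p≤q
... | inj₂ q≤p = q , 0<q , q≤p , ℚ.≤-refl

-- At a fixed index the coefficients 1 - t and t may be slightly negative, since `_≤_` allows any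
-- positive tolerance. The tolerances α and β are scaled by bounds on the coordinates, so that each
-- product with a coordinate reduced by η is above -q.
orthant-convex : ∀ {d} → Convex (Orthant {d})
orthant-convex x y t (η₁ , 0<η₁ , hx) (η₂ , 0<η₂ , hy) 0≤t t≤1
  with η , 0<η , η≤η₁ , η≤η₂ ← positive-lower-bound 0<η₁ 0<η₂ =
  h , 0<½* 0<η , eventually-all λ i →
    let A , 0<A , x≤A        = bounded (seq (x i)) (cauchy (x i))
        B , 0<B , y≤B        = bounded (seq (y i)) (cauchy (y i))
        α , 0<α , Aα≡        = shrink A q 0<A 0<q
        β , 0<β , Bβ≡        = shrink B q 0<B 0<q
        N , hN               = eventually-× (eventually-× hx hy)
                                 (eventually-× (eventually-× x≤A y≤B)
                                   (eventually-× (t≤1 α 0<α) (0≤t β 0<β)))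
    in N , λ k k≥ →
      let (η₁<x , η₂<y) , (x≤A , y≤B) , (t<1+α , 0<t+β) = hN k k≥
      in combine (seq (x i) k) (seq (y i) k) (seq t k)
           (ℚ.≤-<-trans η≤η₁ (η₁<x i)) (ℚ.≤-<-trans η≤η₂ (η₂<y i))
           (ℚ.≤-trans (p≤∣p∣ _) x≤A) (ℚ.≤-trans (p≤∣p∣ _) y≤B)
           0<α 0<β Aα≡ Bβ≡ t<1+α 0<t+β
  where
  -- With h = η/2 and q = η/4, the two errors consume 2q = η/2 of the margin η and leave h.
  h = ½ ℚ.* η
  q = ½ ℚ.* h
  0<q = 0<½* (0<½* 0<η)
  open +-*-Solver
  shift≤ : ∀ {x A} → x ℚ.≤ A → x ℚ.- η ℚ.≤ A
  shift≤ {x} {A} x≤A = subst (x ℚ.- η ℚ.≤_) (ℚ.+-identityʳ A)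
    (ℚ.+-mono-≤ x≤A (ℚ.neg-antimono-≤ (ℚ.<⇒≤ 0<η)))
  combine : ∀ x y t {A B α β} → η ℚ.< x → η ℚ.< y → x ℚ.≤ A → y ℚ.≤ B →
    0ℚ ℚ.< α → 0ℚ ℚ.< β → A ℚ.* α ≡ q → B ℚ.* β ≡ q →
    t ℚ.< 1ℚ ℚ.+ α → 0ℚ ℚ.< t ℚ.+ β → h ℚ.< (1ℚ ℚ.- t) ℚ.* x ℚ.+ t ℚ.* y
  combine x y t {A} {B} {α} {β} η<x η<y x≤A y≤B 0<α 0<β Aα≡ Bβ≡ t<1+α 0<t+β =
    subst (h ℚ.<_) eq (p<p+q h (ℚ.+-mono-<
      (subst (λ r → 0ℚ ℚ.< (1ℚ ℚ.- t) ℚ.* (x ℚ.- η) ℚ.+ r) Aα≡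
        (perturbed-product (1ℚ ℚ.- t) (p<q⇒0<q-p η<x) (shift≤ x≤A) 0<α
          (subst (0ℚ ℚ.<_) (solve 2 (λ α t → con 1ℚ :+ α :- t := con 1ℚ :- t :+ α) refl α t)
            (p<q⇒0<q-p t<1+α))))
      (subst (λ r → 0ℚ ℚ.< t ℚ.* (y ℚ.- η) ℚ.+ r) Bβ≡
        (perturbed-product t (p<q⇒0<q-p η<y) (shift≤ y≤B) 0<β 0<t+β))))
    where
    open ≡-Reasoning
    eq : h ℚ.+ ((1ℚ ℚ.- t) ℚ.* (x ℚ.- η) ℚ.+ q ℚ.+ (t ℚ.* (y ℚ.- η) ℚ.+ q)) ≡
         (1ℚ ℚ.- t) ℚ.* x ℚ.+ t ℚ.* y
    eq = begin
      h ℚ.+ ((1ℚ ℚ.- t) ℚ.* (x ℚ.- η) ℚ.+ q ℚ.+ (t ℚ.* (y ℚ.- η) ℚ.+ q))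
        ≡⟨ solve 6 (λ h x y t η q →
             h :+ ((con 1ℚ :- t) :* (x :- η) :+ q :+ (t :* (y :- η) :+ q)) :=
             (con 1ℚ :- t) :* x :+ t :* y :+ (h :+ (q :+ q) :- η)) refl h x y t η q ⟩
      E ℚ.+ (h ℚ.+ (q ℚ.+ q) ℚ.- η)
        ≡⟨ cong (λ r → E ℚ.+ (h ℚ.+ r ℚ.- η)) (halves h) ⟩
      E ℚ.+ (h ℚ.+ h ℚ.- η)
        ≡⟨ cong (λ r → E ℚ.+ (r ℚ.- η)) (halves η) ⟩
      E ℚ.+ (η ℚ.- η)
        ≡⟨ solve 2 (λ E η → E :+ (η :- η) := E) refl E η ⟩
      E ∎
      where E = (1ℚ ℚ.- t) ℚ.* x ℚ.+ t ℚ.* y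

-- Principal filters and coranks in a finite total order.

module FiniteTotalOrder {n} {_≼_ : Fin n → Fin n → Set} (isTotalOrder : IsTotalOrder _≡_ _≼_) where
  open IsTotalOrder isTotalOrder
    using (antisym; total) renaming (refl to ≼-refl; trans to ≼-trans; reflexive to ≼-reflexive)

  totalOrder : TotalOrder _ _ _
  totalOrder = record { isTotalOrder = isTotalOrder }

  -- When totality returns the opposite comparison, antisymmetry reduces the question to equality in
  -- `Fin n`.
  _≼?_ : Decidable _≼_
  _≼?_ = total∧dec⇒dec ≼-reflexive antisym total Fin._≟_

  filterAbove : Fin n → Subset n
  filterAbove e = tabulate λ f → does (e ≼? f)

  ∈-filterAbove⁺ : ∀ {e f} → e ≼ f → f ∈ filterAbove e
  ∈-filterAbove⁺ {e} {f} e≼f = lookup⇒[]= f _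
    (trans (lookup∘tabulate (λ f → does (e ≼? f)) f) (dec-true (e ≼? f) e≼f))

  ∈-filterAbove⁻ : ∀ {e f} → f ∈ filterAbove e → e ≼ f
  ∈-filterAbove⁻ {e} {f} f∈ with e ≼? f
    | trans (sym (lookup∘tabulate (λ f → does (e ≼? f)) f)) ([]=⇒lookup f∈)
  ... | yes e≼f | _ = e≼f
  ... | no  _   | ()

  corank : Fin n → ℕ
  corank e = card (filterAbove e)

  corank≤n : ∀ e → corank e ℕ.≤ n
  corank≤n e = ∣p∣≤n (filterAbove e)

  filterAbove-anti : ∀ {e f} → e ≼ f → filterAbove f ⊆ filterAbove e
  filterAbove-anti e≼f g∈ = ∈-filterAbove⁺ (≼-trans e≼f (∈-filterAbove⁻ g∈))

  corank-anti-≤ : ∀ {e f} → e ≼ f → corank f ℕ.≤ corank e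
  corank-anti-≤ e≼f = p⊆q⇒∣p∣≤∣q∣ (filterAbove-anti e≼f)

  -- The filters are nested, and e lies in its own filter but not in that of f.
  corank-anti-< : ∀ {e f} → ¬ f ≼ e → corank f ℕ.< corank e
  corank-anti-< {e} {f} f⋠e with total e f
  ... | inj₂ f≼e = contradiction f≼e f⋠e
  ... | inj₁ e≼f = p⊂q⇒∣p∣<∣q∣
    (filterAbove-anti e≼f , e , ∈-filterAbove⁺ ≼-refl , f⋠e ∘ ∈-filterAbove⁻)

  ≼∧≢⇒⋡ : ∀ {e f} → e ≼ f → ¬ e ≡ f → ¬ f ≼ e
  ≼∧≢⇒⋡ e≼f e≢f f≼e = e≢f (antisym e≼f f≼e)

  least-element : ∀ X → Nonempty X → ∃[ e ] e ∈ X × (∀ {f} → f ∈ X → e ≼ f)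
  -- The given member e is the default value of `min`, which keeps the minimum inside X.
  least-element X (e , e∈X) = min e fs
    , argmin-all (λ f → f) {P = _∈ X} e∈X (all-filter (_∈? X) (List.allFin n))
    , λ {f} f∈X → All.lookup (f[argmin]≤f[xs] e fs) (∈-filter⁺ (_∈? X) (∈-allFin f) f∈X)
    where
    open Extrema totalOrder using (min; argmin-all; f[argmin]≤f[xs])
    fs = List.filter (_∈? X) (List.allFin n)

-- Weighted sums with powers of M as weights.

module Weights (n d : ℕ) where
  -- The threshold `B` lies strictly between d Mⁿ, which bounds d terms of size at most Mⁿ, and Mⁿ⁺¹
  -- = (d + 2) Mⁿ, which a single large term reaches.
  M B : ℕ
  M = 2 ℕ.+ d
  B = ℕ.suc d ℕ.* M ^ n

  weighted : (Fin d → ℕ) → Vector ℚ d → Vector ℚ d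
  weighted r z i = fromℕ (M ^ r i) ℚ.* z i

  powers : (Fin d → ℕ) → Vector ℚ d
  powers p i = fromℕ (M ^ p i)

  1≤M^ : ∀ m → 1 ℕ.≤ M ^ m
  1≤M^ = ℕ.m^n>0 M

  weighted-power : ∀ (r p : Fin d → ℕ) i → weighted r (powers p) i ≡ fromℕ (M ^ (r i ℕ.+ p i))
  weighted-power r p i = trans (sym (×1-homo-* (M ^ r i) (M ^ p i)))
    (cong fromℕ (sym (ℕ.^-distribˡ-+-* M (r i) (p i))))

  powers-below : ∀ (r p : Fin d → ℕ) → (∀ i → r i ℕ.+ p i ℕ.≤ n) →
    ∑ (weighted r (powers p)) ℚ.< fromℕ B
  powers-below r p r+p≤n = begin-strict
    ∑ (weighted r (powers p))
      ≤⟨ ∑≤ (weighted r (powers p)) (fromℕ (M ^ n)) (λ i → ℚ.≤-trans (ℚ.≤-reflexive (weighted-power r p i))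
           (fromℕ-mono-≤ (ℕ.^-monoʳ-≤ M (r+p≤n i)))) ⟩
    fromℕ d ℚ.* fromℕ (M ^ n)
      ≡⟨ ×1-homo-* d (M ^ n) ⟨
    fromℕ (d ℕ.* M ^ n)
      <⟨ fromℕ-mono-< (ℕ.+-monoˡ-≤ (d ℕ.* M ^ n) (1≤M^ n)) ⟩
    fromℕ B ∎
    where open ℚ.≤-Reasoning

  powers-above : ∀ (r p : Fin d → ℕ) i → n ℕ.< r i ℕ.+ p i →
    fromℕ B ℚ.< ∑ (weighted r (powers p))
  powers-above r p i n<r+p = begin-strict
    fromℕ B
      -- The power Mⁿ⁺¹ unfolds to Mⁿ + `B`, and Mⁿ is at least 1.
      <⟨ fromℕ-mono-< (ℕ.+-monoˡ-≤ B (1≤M^ n)) ⟩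
    fromℕ (M ^ ℕ.suc n)
      ≤⟨ fromℕ-mono-≤ (ℕ.^-monoʳ-≤ M n<r+p) ⟩
    fromℕ (M ^ (r i ℕ.+ p i))
      ≡⟨ weighted-power r p i ⟨
    weighted r (powers p) i
      ≤⟨ term≤∑ (weighted r (powers p)) (λ i → subst (0ℚ ℚ.≤_) (sym (weighted-power r p i)) (0≤fromℕ (M ^ (r i ℕ.+ p i)))) i ⟩
    ∑ (weighted r (powers p)) ∎
    where open ℚ.≤-Reasoning

  -- Coordinate i is compared with its own weight vector `s i`, and only in the diagonal entry.
  -- Raising the exponent by at least one gains a factor M, so M times each term is below b; the sum
  -- of d such terms is at most d b < M b, and M cancels.
  dominated-below : ∀ r (s : Fin d → Fin d → ℕ) z b → 0ℚ ℚ.< b → (∀ i → 0ℚ ℚ.≤ z i) →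
    (∀ i → r i ℕ.< s i i) → (∀ i → ∑ (weighted (s i) z) ℚ.< b) → ∑ (weighted r z) ℚ.< b
  dominated-below r s z b 0<b 0≤z r<s s<b =
    ℚ.*-cancelˡ-<-nonNeg (fromℕ M) {{ℚ.nonNegative (0≤fromℕ M)}} (begin-strict
      fromℕ M ℚ.* ∑ (weighted r z)
        ≡⟨ *-distribˡ-sum (fromℕ M) (weighted r z) ⟩
      ∑ (λ i → fromℕ M ℚ.* weighted r z i)
        ≤⟨ ∑≤ (λ i → fromℕ M ℚ.* weighted r z i) b term≤b ⟩
      fromℕ d ℚ.* b
        -- Strictness enters here, from d < M and 0 < b, which also covers the empty sum.
        <⟨ ℚ.*-monoˡ-<-pos b {{ℚ.positive 0<b}} (fromℕ-mono-< (ℕ.m≤n+m (ℕ.suc d) 1)) ⟩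
      fromℕ M ℚ.* b ∎)
    where
    open ℚ.≤-Reasoning
    term≤b : ∀ i → fromℕ M ℚ.* weighted r z i ℚ.≤ b
    term≤b i = begin
      fromℕ M ℚ.* weighted r z i
        ≡⟨ ℚ.*-assoc (fromℕ M) (fromℕ (M ^ r i)) (z i) ⟨
      fromℕ M ℚ.* fromℕ (M ^ r i) ℚ.* z i
        ≡⟨ cong (ℚ._* z i) (×1-homo-* M (M ^ r i)) ⟨
      fromℕ (M ^ ℕ.suc (r i)) ℚ.* z i
        ≤⟨ ℚ.*-monoʳ-≤-nonNeg (z i) {{ℚ.nonNegative (0≤z i)}} (fromℕ-mono-≤ (ℕ.^-monoʳ-≤ M (r<s i))) ⟩
      weighted (s i) z i
        ≤⟨ term≤∑ (weighted (s i) z) (λ j → 0≤* (fromℕ (M ^ s i j)) (z j) (0≤fromℕ (M ^ s i j)) (0≤z j)) i ⟩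
      ∑ (weighted (s i) z)
        <⟨ s<b i ⟩
      b ∎

-- The hyperplanes of a generating set of orders.

generated⇒realizable : ∀ {n d} {𝒞 : Family n} → 1 ℕ.≤ d → GeneratedBy d 𝒞 → Realizable 𝒞 d
generated⇒realizable {n} {d} {𝒞} 1≤d (_≤[_]_ , gen) = record
  { a              = a
  ; b              = λ _ → b
  ; a≄0            = a≄0
  ; K              = Orthant
  ; relativelyOpen = orthant-relativelyOpen
  ; convex         = orthant-convex
  ; realizes       = λ X → mk⇔ (realize X) λ (y , y>0 , pos , neg) → feasible X y y>0 pos neg
  }
  where
  open Generates gen
  open Weights n d
  module Order i = FiniteTotalOrder (totalOrders i)

  r : Fin n → Fin d → ℕ
  r e i = Order.corank i e

  -- The signs are reversed so that the positive side is the one where the weighted sum is below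
  -- `B`.
  a : Fin n → ℝ^ d
  a e i = fromℚ (ℚ.- fromℕ (M ^ r e i))

  b : ℝ
  b = fromℚ (ℚ.- fromℕ B)

  i₀ : Fin d
  i₀ = fromℕ< 1≤d

  a≄0 : ∀ e → ¬ (a e ≃ᵥ 0ᵥ)
  a≄0 e a≃0 =
    -- Tolerance 1 already gives a contradiction, because every entry has absolute value at least 1.
    let N , h = a≃0 i₀ 1ℚ (ℚ.positive⁻¹ 1ℚ)
        w     = fromℕ (M ^ r e i₀)
    in ℚ.<-irrefl refl (begin-strict
      1ℚ                        ≤⟨ fromℕ-mono-≤ (1≤M^ (r e i₀)) ⟩
      w                         ≡⟨ ℚ.0≤p⇒∣p∣≡p (0≤fromℕ (M ^ r e i₀)) ⟨
      ℚ.∣ w ∣                   ≡⟨ ℚ.∣-p∣≡∣p∣ w ⟨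
      ℚ.∣ ℚ.- w ∣               ≡⟨ cong ℚ.∣_∣ (ℚ.+-identityʳ (ℚ.- w)) ⟨
      ℚ.∣ ℚ.- w ℚ.- 0ℚ ∣        <⟨ h N ℕ.≤-refl ⟩
      1ℚ                        ∎)
    where open ℚ.≤-Reasoning

  seq-a· : ∀ e y k → seq (a e · y) k ≡ ℚ.- ∑ (weighted (r e) (λ i → seq (y i) k))
  seq-a· e y k = trans (seq-sum (λ i → a e i * y i) k)
    (neg-∑ (λ i → fromℕ (M ^ r e i)) (λ i → seq (y i) k))

  powerPoint : (Fin d → ℕ) → ℝ^ d
  powerPoint p i = fromℚ (powers p i)

  powerPoint-orthant : ∀ p → Orthant (powerPoint p)
  powerPoint-orthant p = ½ , ℚ.positive⁻¹ ½ , 0 , λ _ _ i →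
    ℚ.<-≤-trans (from-yes (½ ℚ.<? 1ℚ)) (fromℕ-mono-≤ (1≤M^ (p i)))

  powerPoint-H⁺ : ∀ e p → (∀ i → r e i ℕ.+ p i ℕ.≤ n) → H⁺ (a e) b (powerPoint p)
  powerPoint-H⁺ e p h = constant-< b (a e · powerPoint p) (λ _ → refl) (seq-a· e (powerPoint p))
    (ℚ.neg-antimono-< (powers-below (r e) p h))

  powerPoint-H⁻ : ∀ e p i → n ℕ.< r e i ℕ.+ p i → H⁻ (a e) b (powerPoint p)
  powerPoint-H⁻ e p i h = constant-< (a e · powerPoint p) b (seq-a· e (powerPoint p)) (λ _ → refl)
    (ℚ.neg-antimono-< (powers-above (r e) p i h))

  realize : ∀ X → 𝒞 X → ∃[ y ] Orthant y
    × (∀ e → e ∈ X → H⁺ (a e) b y) × (∀ e → e ∉ X → H⁻ (a e) b y)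
  realize X X∈𝒞 with nonempty? X
  -- For the empty set, the exponent n + 1 makes the term at `i₀` alone exceed `B` for every
  -- element.
  ... | no X≡∅ = powerPoint p , powerPoint-orthant p
    , (λ e e∈X → contradiction (e , e∈X) X≡∅)
    , λ e _ → powerPoint-H⁻ e p i₀ (ℕ.m≤n+m (ℕ.suc n) (r e i₀))
    where p = λ (_ : Fin d) → ℕ.suc n
  ... | yes X≢∅ with m , m-generates ← Equivalence.to (nonempty X X≢∅) X∈𝒞 =
    powerPoint p , powerPoint-orthant p , inside-X , outside-X
    where
    -- This choice makes the i-th term of `m i` equal to Mⁿ. The truncated subtraction is exact
    -- because coranks are at most n.
    p : Fin d → ℕ
    p i = n ∸ r (m i) i
    r+p≡n : ∀ i → r (m i) i ℕ.+ p i ≡ n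
    r+p≡n i = ℕ.m+[n∸m]≡n (Order.corank≤n i (m i))
    inside-X : ∀ e → e ∈ X → H⁺ (a e) b (powerPoint p)
    inside-X e e∈X = powerPoint-H⁺ e p λ i → subst (r e i ℕ.+ p i ℕ.≤_) (r+p≡n i)
      (ℕ.+-monoˡ-≤ (p i) (Order.corank-anti-≤ i (Equivalence.to (m-generates e) e∈X i)))
    outside-X : ∀ e → e ∉ X → H⁻ (a e) b (powerPoint p)
    outside-X e e∉X =
      -- Decidability of the orders yields an explicit order in which e fails to lie above its
      -- generator; its term there is at least Mⁿ⁺¹.
      let i , m⋠e = ¬∀⟶∃¬ d _ (λ i → Order._≼?_ i (m i) e) (e∉X ∘ Equivalence.from (m-generates e))
      in powerPoint-H⁻ e p i (subst (ℕ._< r e i ℕ.+ p i) (r+p≡n i)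
           (ℕ.+-monoˡ-< (p i) (Order.corank-anti-< i m⋠e)))

  feasible : ∀ X y → Orthant y →
    (∀ e → e ∈ X → H⁺ (a e) b y) → (∀ e → e ∉ X → H⁻ (a e) b y) → 𝒞 X
  feasible X y (η , 0<η , y>η) pos neg with nonempty? X
  ... | no X≡∅ = subst 𝒞 (sym (Empty-unique X≡∅)) ⊥-closed
  ... | yes X≢∅ = Equivalence.from (nonempty X X≢∅) (m , λ x →
    mk⇔ (λ x∈X i → proj₂ (proj₂ (least i)) x∈X)
        (λ m≼x → decidable-stable (x ∈? X) (separate x m≼x)))
    where
    least : ∀ i → _
    least i = Order.least-element i X X≢∅
    m : Fin d → Fin n
    m i = proj₁ (least i)
    m∈X : ∀ i → m i ∈ X
    m∈X i = proj₁ (proj₂ (least i))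
    separate : ∀ x → (∀ i → m i ≤[ i ] x) → ¬ x ∉ X
    separate x m≼x x∉X =
      -- Finitely many strict inequalities hold together at one late index, where the rest of the
      -- argument takes place in ℚ.
      let N , hN = eventually-× y>η (eventually-×
                     (eventually-all (λ i → <⇒eventually b (a (m i) · y) (pos (m i) (m∈X i))))
                     (<⇒eventually (a x · y) b (neg x x∉X)))
          y>η , above , below = hN N ℕ.≤-refl
          z = λ i → seq (y i) N
          below-B = dominated-below (r x) (λ i → r (m i)) z (fromℕ B)
            (fromℕ-mono-< (ℕ.≤-trans (1≤M^ n) (ℕ.m≤m+n (M ^ n) (d ℕ.* M ^ n))))
            (λ i → ℚ.<⇒≤ (ℚ.<-trans 0<η (y>η i)))
            -- Since `m i` is in X and x is not, they differ, so x is strictly above `m i`.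
            (λ i → Order.corank-anti-< i (Order.≼∧≢⇒⋡ i (m≼x i)
              λ m≡x → x∉X (subst (_∈ X) m≡x (m∈X i))))
            (λ i → neg-cancel-< _ _ (subst (ℚ.- fromℕ B ℚ.<_) (seq-a· (m i) y N) (above i)))
      in ℚ.<-asym below-B
           (neg-cancel-< _ _ (subst (ℚ._< ℚ.- fromℕ B) (seq-a· x y N) below))

theorem35 : ∀ (n : ℕ) (𝒞 : Family n) → IsConvexGeometry 𝒞 →
    ∀ (d : ℕ) → IsConvexDimension 𝒞 d → Realizable 𝒞 d
theorem35 n 𝒞 _ d cdim = generated⇒realizable positive generated
  where open IsConvexDimension cdim
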